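{- Let $s\ge1$ and $n\ge0$ be integers. If $n\leq s$, then $A_{231,321}(U_{\mathrm{spine}=s,n}^\alpha)=1$. If $n>s$, then \[A_{231,321}(U_{\mathrm{spine}=s,n}^\alpha)=\sum_{j=1}^sA_{231,321}(U_{\mathrm{spine}=s,n-j}^\alpha).\]
   Context: For integers $s\ge1$ and $n\ge 0$, the labeled uneven comb $U^\alpha_{\mathrm{spine}=s,n}$ is the poset on $\{1,\dots,n\}$ whose order is generated by the covering relations $i\lessdot i+1$ for $1\le i\le s-1$ with $i+1\le n$, and $i\lessdot i+s$ whenever $i+s\le n$. A linear extension is viewed as a permutation of $[n]$ in which $x$ precedes $y$ whenever $x<y$ in the poset. $A_{231,321}(P)$ denotes the number of linear extensions of $P$ that avoid both patterns $231$ and $321$. -}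

module Defs where

open import Data.Fin using (Fin; toℕ; _<_)
open import Data.Fin.Induction using (>-wellFounded)
open import Data.Fin.Patterns using (0F; 1F; 2F)
import Data.Fin.Properties as Fin
open import Data.List as List using (List; allFin; cartesianProductWith; filter; length)
open import Data.Nat as ℕ using (ℕ; zero; suc; _+_; _∸_; _≤_; NonZero)
import Data.Nat.Properties as ℕ
open import Data.Product using (_×_; _,_; proj₁; proj₂; ∃; ∃₂; map₂)
open import Data.Vec as Vec using (Vec; []; _∷_; lookup)
import Data.Vec.Relation.Unary.AllPairs as AllPairs
open AllPairs using (AllPairs)
open import Data.Vec.Relation.Unary.Unique.Propositional using (Unique)
open import Function using (_∘_; _⇔_; mk⇔; Equivalence)
open import Induction.WellFounded using (Acc; acc)
open import Level using (0ℓ)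
open import Relation.Binary using (Rel; Decidable; IsDecStrictPartialOrder)
open import Relation.Binary.Construct.Closure.Transitive as Plus
  using (TransClosure; [_]; _∷_)
open import Relation.Binary.PropositionalEquality
  using (_≡_; refl; sym; subst; subst₂; resp₂; isEquivalence)
open import Relation.Nullary using (Dec; yes; no; ¬_; ¬?)
open import Relation.Nullary.Decidable using (map′; _×-dec_; _→-dec_; _⊎-dec_)
open import Data.Sum using (_⊎_; inj₁; inj₂)
import Relation.Unary as Unary

private
  variable
    k m n : ℕ

-- The set [n] = {1,…,n} is represented by Fin n, and x : Fin n carries the
-- label suc (toℕ x).

label : Fin n → ℕ
label x = suc (toℕ x)

record LabeledPoset (n : ℕ) : Set₁ where
  field
    _≺_                     : Rel (Fin n) 0ℓ
    isDecStrictPartialOrder : IsDecStrictPartialOrder _≡_ _≺_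

  open IsDecStrictPartialOrder isDecStrictPartialOrder public
    using () renaming (_<?_ to _≺?_)

-- A permutation of [n] in one-line notation is a word of length n over [n]
-- with pairwise distinct entries.

Word : ℕ → Set
Word n = Vec (Fin n) n

Precedes : Word n → Rel (Fin n) 0ℓ
Precedes π x y = ∃₂ λ i j → i < j × lookup π i ≡ x × lookup π j ≡ y

IsLinearExtension : LabeledPoset n → Word n → Set
IsLinearExtension P π = Unique π × (∀ x y → x ≺ y → Precedes π x y)
  where open LabeledPoset P

OrderIsomorphic : Vec (Fin m) k → Vec (Fin n) k → Set
OrderIsomorphic u v =
  ∀ a b → (lookup u a < lookup u b) ⇔ (lookup v a < lookup v b)

Contains : Word k → Word n → Set
Contains {k} {n} τ π = ∃ λ (is : Vec (Fin n) k) →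
  AllPairs _<_ is × OrderIsomorphic (Vec.map (lookup π) is) τ

Avoids : Word k → Word n → Set
Avoids τ π = ¬ Contains τ π

p231 p321 : Word 3
p231 = 1F ∷ 2F ∷ 0F ∷ []
p321 = 2F ∷ 1F ∷ 0F ∷ []

IsAvoidingExtension : LabeledPoset n → Word n → Set
IsAvoidingExtension P π = IsLinearExtension P π × Avoids p231 π × Avoids p321 π

precedes? : (π : Word n) → Decidable (Precedes π)
precedes? π x y = Fin.any? λ i → Fin.any? λ j →
  (i Fin.<? j) ×-dec (lookup π i Fin.≟ x) ×-dec (lookup π j Fin.≟ y)

isLinearExtension? : (P : LabeledPoset n) → Unary.Decidable (IsLinearExtension P)
isLinearExtension? P π =
  AllPairs.allPairs? (λ x y → ¬? (x Fin.≟ y)) π ×-dec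
  Fin.all? λ x → Fin.all? λ y → (x ≺? y) →-dec precedes? π x y
  where open LabeledPoset P

orderIsomorphic? : (u : Vec (Fin m) k) (v : Vec (Fin n) k) → Dec (OrderIsomorphic u v)
orderIsomorphic? u v = Fin.all? λ a → Fin.all? λ b →
  let p = lookup u a Fin.<? lookup u b
      q = lookup v a Fin.<? lookup v b
  in map′ (λ (f , g) → mk⇔ f g) (λ e → Equivalence.to e , Equivalence.from e)
       ((p →-dec q) ×-dec (q →-dec p))

anyVec? : ∀ {k} {Q : Vec (Fin n) k → Set} → Unary.Decidable Q → Dec (∃ Q)
anyVec? {k = zero}  Q? = map′ ([] ,_) (λ { ([] , q) → q }) (Q? [])
anyVec? {k = suc k} Q? =
  map′ (λ (x , xs , q) → x ∷ xs , q) (λ { (x ∷ xs , q) → x , xs , q })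
    (Fin.any? λ x → anyVec? λ xs → Q? (x ∷ xs))

contains? : (τ : Word k) (π : Word n) → Dec (Contains τ π)
contains? τ π = anyVec? λ is →
  AllPairs.allPairs? Fin._<?_ is ×-dec orderIsomorphic? (Vec.map (lookup π) is) τ

isAvoidingExtension? : (P : LabeledPoset n) → Unary.Decidable (IsAvoidingExtension P)
isAvoidingExtension? P π =
  isLinearExtension? P π ×-dec ¬? (contains? p231 π) ×-dec ¬? (contains? p321 π)

-- Every vector of length k over [n], each listed exactly once.

allVecs : ∀ n k → List (Vec (Fin n) k)
allVecs n zero    = List.[ [] ]
allVecs n (suc k) = cartesianProductWith _∷_ (allFin n) (allVecs n k)

A₂₃₁,₃₂₁ : LabeledPoset n → ℕ
A₂₃₁,₃₂₁ {n} P = length (filter (isAvoidingExtension? P) (allVecs n n))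

data Cover (s : ℕ) {n : ℕ} (x y : Fin n) : Set where
  spine : label x ≤ s ∸ 1 → label y ≡ label x + 1 → Cover s x y
  tooth : label y ≡ label x + s → Cover s x y

cover? : ∀ s → Decidable (Cover s {n})
cover? s x y = map′
  (λ { (inj₁ (p , q)) → spine p q ; (inj₂ q) → tooth q })
  (λ { (spine p q) → inj₁ (p , q) ; (tooth q) → inj₂ q })
  (((label x ℕ.≤? s ∸ 1) ×-dec (label y ℕ.≟ label x + 1))
    ⊎-dec (label y ℕ.≟ label x + s))

module _ (s : ℕ) .{{_ : NonZero s}} where

  cover⇒< : {x y : Fin n} → Cover s x y → x < y
  cover⇒< {x = x} (spine _ q) =
    ℕ.s<s⁻¹ (subst (label x ℕ.<_) (sym q) (ℕ.m<m+n (label x) (ℕ.s≤s ℕ.z≤n)))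
  cover⇒< {x = x} (tooth q) =
    ℕ.s<s⁻¹ (subst (label x ℕ.<_) (sym q) (ℕ.m<m+n (label x) (ℕ.>-nonZero⁻¹ s)))

  cover⁺⇒< : {x y : Fin n} → TransClosure (Cover s) x y → x < y
  cover⁺⇒< [ c ]   = cover⇒< c
  cover⁺⇒< (c ∷ p) = ℕ.<-trans (cover⇒< c) (cover⁺⇒< p)

  cover⁺? : Decidable (TransClosure (Cover s {n}))
  cover⁺? x y = go x (>-wellFounded x)
    where
    go : ∀ x → Acc Data.Fin._>_ x → Dec (TransClosure (Cover s) x y)
    go x (acc rec) = map′
      (λ { (inj₁ c) → [ c ] ; (inj₂ (_ , c , p)) → c ∷ p })
      (λ { [ c ] → inj₁ c ; (c ∷ p) → inj₂ (_ , c , p) })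
      (cover? s x y ⊎-dec Fin.any? step)
      where
      step : ∀ z → Dec (Cover s x z × TransClosure (Cover s) z y)
      step z with cover? s x z
      ... | no ¬c = no (¬c ∘ proj₁)
      ... | yes c = map′ (c ,_) proj₂ (go z (rec (cover⇒< c)))

  unevenComb : ∀ n → LabeledPoset n
  unevenComb n = record
    { _≺_ = TransClosure (Cover s)
    ; isDecStrictPartialOrder = record
      { isStrictPartialOrder = record
        { isEquivalence = isEquivalence
        ; irrefl        = λ { refl p → ℕ.<-irrefl refl (cover⁺⇒< p) }
        ; trans         = Plus._++_
        ; <-resp-≈      = resp₂ _
        }
      ; _≟_  = Fin._≟_
      ; _<?_ = cover⁺?
      }
    }

{-# OPTIONS --safe #-}
module Submission where

-- Avoiding 231 and 321 means that every entry has at most one larger entry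
-- before it.  If the maximum n of such a permutation sits at position p, then
-- the entries after it increase and exceed all entries before it, so the
-- permutation is an avoiding permutation of [p − 1] followed by
-- n, p, p+1, …, n−1.  Such a tail inverts exactly the pairs (x, n) with
-- p ≤ x < n, so the word is a linear extension iff its prefix is one and no
-- such x lies below n in the comb.  If n > s this means n − p < s, because
-- the only element covered by n is n − s; if n ≤ s it forces p = n, because
-- n − 1 is covered by n.

open import Defs
open import Data.Fin as Fin using (Fin; toℕ; fromℕ; fromℕ<; inject; inject≤; opposite; punchIn; punchOut)
open import Data.Fin.Patterns using (0F; 1F; 2F)
import Data.Fin.Properties as Fin
open import Data.List as List using (List; applyUpTo; concat; filter; length; map; sum; upTo)
import Data.List.Membership.Propositional as List
import Data.List.Membership.Propositional.Properties as List
open import Data.List.Membership.Propositional.Properties.WithK using (unique∧set⇒bag)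
import Data.List.Properties as List
open import Data.List.Relation.Binary.BagAndSetEquality using (∼bag⇒↭)
open import Data.List.Relation.Binary.Permutation.Propositional.Properties using (↭-length)
import Data.List.Relation.Unary.All.Properties as All
open import Data.List.Relation.Unary.All using ([])
open import Data.List.Relation.Unary.AllPairs using ([]; _∷_)
import Data.List.Relation.Unary.AllPairs.Properties as AllPairs
import Data.List.Relation.Unary.Any as Any
import Data.List.Relation.Unary.Any.Properties as Any
import Data.List.Relation.Unary.Unique.Propositional as List
import Data.List.Relation.Unary.Unique.Propositional.Properties as Unique
open import Data.Nat using (ℕ; zero; suc; _+_; _∸_; _≤_; _<_; NonZero; z≤n; s≤s; s≤s⁻¹; s<s⁻¹; z<s; >-nonZero; >-nonZero⁻¹)
open import Data.Nat.Properties
open import Data.Product using (_×_; _,_; proj₂; ∃)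
open import Data.Sum using (inj₁; inj₂)
open import Data.Vec as Vec using (Vec; []; _∷_; lookup; tabulate)
open import Data.Vec.Properties using (lookup∘tabulate; tabulate∘lookup; tabulate-cong; ∷-injective)
import Data.Vec.Relation.Unary.All as VecAll
import Data.Vec.Relation.Unary.AllPairs as VecAllPairs
open import Data.Vec.Relation.Unary.Unique.Propositional using () renaming (Unique to VecUnique)
open import Data.Vec.Relation.Unary.Unique.Propositional.Properties using (tabulate⁺; lookup-injective)
open import Function using (_∘_; mk⇔; Equivalence; Injective)
open import Relation.Binary.Construct.Closure.Transitive using (TransClosure; [_]; _∷_)
open import Relation.Binary.Definitions using (tri<; tri≈; tri>)
open import Relation.Binary.PropositionalEquality
open import Relation.Nullary using (¬_; ¬?; yes; no; contradiction; from-yes)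

private
  variable
    k m n s : ℕ
    X : Set

-- Injective self-maps of a finite set

-- If y were missed, punching it out of the codomain would inject `Fin (suc n)` into `Fin n`.
injective⇒surjective : {f : Fin n → Fin n} → Injective _≡_ _≡_ f → ∀ y → ∃ λ x → f x ≡ y
injective⇒surjective {suc n} {f} f-inj y with Fin.any? (λ x → f x Fin.≟ y)
... | yes hit = hit
... | no miss = contradiction (Fin.injective⇒≤ g-inj) 1+n≰n
  where
  y≢f : ∀ x → y ≢ f x
  y≢f x y≡fx = miss (x , sym y≡fx)

  g-inj : Injective _≡_ _≡_ (λ x → punchOut (y≢f x))
  g-inj {x} {x′} eq = f-inj (Fin.punchOut-injective (y≢f x) (y≢f x′) eq)

-- The values at the positions before k are distinct and lie below f k, so f restricts to an
-- injection from `Fin (toℕ k)` into `Fin (toℕ (f k))`.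
record-low⇒≥ : {f : Fin n → Fin n} → Injective _≡_ _≡_ f → ∀ k →
               (∀ i → i Fin.< k → f i Fin.< f k) → k Fin.≤ f k
record-low⇒≥ {f = f} f-inj k below = Fin.injective⇒≤ g-inj
  where
  inject<k : (i : Fin (toℕ k)) → inject {i = k} i Fin.< k
  inject<k i = subst (_< toℕ k) (sym (Fin.toℕ-inject i)) (Fin.toℕ<n i)

  g : Fin (toℕ k) → Fin (toℕ (f k))
  g i = fromℕ< (below (inject i) (inject<k i))

  g-inj : Injective _≡_ _≡_ g
  g-inj {i} {j} eq = Fin.toℕ-injective (begin
    toℕ i                   ≡⟨ Fin.toℕ-inject {i = k} i ⟨
    toℕ (inject {i = k} i)  ≡⟨ cong toℕ (f-inj (Fin.toℕ-injective fi≡fj)) ⟩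
    toℕ (inject {i = k} j)  ≡⟨ Fin.toℕ-inject {i = k} j ⟩
    toℕ j                   ∎)
    where
    open ≡-Reasoning
    fi≡fj : toℕ (f (inject i)) ≡ toℕ (f (inject j))
    fi≡fj = trans (sym (Fin.toℕ-fromℕ< _)) (trans (cong toℕ eq) (Fin.toℕ-fromℕ< _))

opposite-anti-< : {i j : Fin n} → i Fin.< j → opposite j Fin.< opposite i
opposite-anti-< {i = i} {j} i<j =
  subst₂ _<_ (sym (Fin.opposite-prop j)) (sym (Fin.opposite-prop i))
    (∸-monoʳ-< (s≤s i<j) (Fin.toℕ<n j))

opposite-cancel-≤ : {i j : Fin n} → opposite i Fin.≤ opposite j → j Fin.≤ i
opposite-cancel-≤ {i = i} {j} le with toℕ j ≤? toℕ i
... | yes j≤i = j≤i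
... | no  j≰i = contradiction le (<⇒≱ (opposite-anti-< {i = i} {j} (≰⇒> j≰i)))

opposite-injective : Injective _≡_ _≡_ (opposite {n})
opposite-injective {x = i} {j} eq =
  trans (sym (Fin.opposite-involutive i)) (trans (cong opposite eq) (Fin.opposite-involutive j))

-- By the pigeonhole principle an entry exceeding all earlier ones has f k ≥ k;
-- reversing and complementing gives the other inequality.
strong-fixed-point : {f : Fin n → Fin n} → Injective _≡_ _≡_ f → ∀ k →
                     (∀ i → i Fin.< k → f i Fin.< f k) →
                     (∀ i → k Fin.< i → f k Fin.< f i) → f k ≡ k
strong-fixed-point {f = f} f-inj k below above = Fin.≤-antisym
  (opposite-cancel-≤ (subst (opposite k Fin.≤_) g[k]≡ (record-low⇒≥ g-inj (opposite k) g-below)))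
  (record-low⇒≥ f-inj k below)
  where
  g = opposite ∘ f ∘ opposite

  g[k]≡ : g (opposite k) ≡ opposite (f k)
  g[k]≡ = cong (opposite ∘ f) (Fin.opposite-involutive k)

  g-inj : Injective _≡_ _≡_ g
  g-inj = opposite-injective ∘ f-inj ∘ opposite-injective

  g-below : ∀ i → i Fin.< opposite k → g i Fin.< g (opposite k)
  g-below i i<k′ = subst (g i Fin.<_) (sym g[k]≡) (opposite-anti-<
    (above (opposite i) (subst (Fin._< opposite i) (Fin.opposite-involutive k) (opposite-anti-< i<k′))))

-- Avoiding linear extensions described by positions

lookup-extensional : {xs ys : Vec X n} → (∀ i → lookup xs i ≡ lookup ys i) → xs ≡ ys
lookup-extensional {xs = xs} {ys} eq =
  trans (sym (tabulate∘lookup xs)) (trans (tabulate-cong eq) (tabulate∘lookup ys))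

val : Word n → Fin n → ℕ
val w i = toℕ (lookup w i)

cover-cong : {x y : Fin m} {x′ y′ : Fin n} → toℕ x ≡ toℕ x′ → toℕ y ≡ toℕ y′ →
             Cover s x y → Cover s x′ y′
cover-cong {s = s} x≡ y≡ (spine x≤ y≡x+1) =
  spine (subst (λ a → suc a ≤ s ∸ 1) x≡ x≤)
        (subst₂ (λ a b → suc b ≡ suc a + 1) x≡ y≡ y≡x+1)
cover-cong {s = s} x≡ y≡ (tooth y≡x+s) =
  tooth (subst₂ (λ a b → suc b ≡ suc a + s) x≡ y≡ y≡x+s)

-- A working form of `IsAvoidingExtension`: `sparse` merges the two forbidden patterns into one
-- condition, and `monotone` asks only about covers, which generate the order.
record Good (s : ℕ) (w : Word n) : Set where
  field
    injective : Injective _≡_ _≡_ (lookup w)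
    sparse    : ∀ {i j k} → i Fin.< j → j Fin.< k →
                lookup w k Fin.< lookup w i → ¬ lookup w k Fin.< lookup w j
    monotone  : ∀ {i j} → Cover s (lookup w i) (lookup w j) → i Fin.< j

-- Since τ has distinct entries, trichotomy turns preservation of < into reflection of <.
orderIsomorphic : (u : Vec (Fin n) k) (τ : Word k) → Injective _≡_ _≡_ (lookup τ) →
                  (∀ a b → lookup τ a Fin.< lookup τ b → lookup u a Fin.< lookup u b) →
                  OrderIsomorphic u τ
orderIsomorphic u τ τ-inj mono a b = mk⇔ reflect (mono a b)
  where
  reflect : lookup u a Fin.< lookup u b → lookup τ a Fin.< lookup τ b
  reflect u< with Fin.<-cmp (lookup τ a) (lookup τ b)
  ... | tri< τ< _ _ = τ<
  ... | tri≈ _ τ≡ _ = contradiction u< (Fin.<-irrefl (cong (lookup u) (τ-inj τ≡)))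
  ... | tri> _ _ τ> = contradiction u< (<-asym (mono b a τ>))

p231-injective : Injective _≡_ _≡_ (lookup p231)
p231-injective = lookup-injective
  (from-yes (VecAllPairs.allPairs? (λ x y → ¬? (x Fin.≟ y)) p231)) _ _

p321-injective : Injective _≡_ _≡_ (lookup p321)
p321-injective = lookup-injective
  (from-yes (VecAllPairs.allPairs? (λ x y → ¬? (x Fin.≟ y)) p321)) _ _

module _ (w : Word n) {i j k : Fin n} (i<j : i Fin.< j) (j<k : j Fin.< k) where

  private
    increasing : VecAllPairs.AllPairs Fin._<_ (i ∷ j ∷ k ∷ [])
    increasing = (i<j VecAll.∷ <-trans i<j j<k VecAll.∷ VecAll.[])
      VecAllPairs.∷ (j<k VecAll.∷ VecAll.[])
      VecAllPairs.∷ VecAll.[] VecAllPairs.∷ VecAllPairs.[]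

  contains-231 : lookup w k Fin.< lookup w i → lookup w i Fin.< lookup w j → Contains p231 w
  contains-231 k<i i<j′ = _ , increasing , orderIsomorphic (Vec.map (lookup w) (i ∷ j ∷ k ∷ [])) p231 p231-injective λ where
    0F 0F (s≤s ())
    0F 1F _ → i<j′
    1F 0F (s≤s ())
    1F 1F (s≤s (s≤s ()))
    2F 0F _ → k<i
    2F 1F _ → <-trans k<i i<j′
    0F 2F ()
    1F 2F ()
    2F 2F ()

  contains-321 : lookup w k Fin.< lookup w j → lookup w j Fin.< lookup w i → Contains p321 w
  contains-321 k<j j<i = _ , increasing , orderIsomorphic (Vec.map (lookup w) (i ∷ j ∷ k ∷ [])) p321 p321-injective λ where
    0F 0F (s≤s (s≤s ()))
    0F 1F (s≤s ())
    1F 0F _ → j<i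
    1F 1F (s≤s ())
    2F 0F _ → <-trans k<j j<i
    2F 1F _ → k<j
    0F 2F ()
    1F 2F ()
    2F 2F ()

-- In both 231 and 321 the last entry is the smallest, so an occurrence yields an entry with two
-- larger entries before it.
sparse⇒avoids : (w : Word n) (τ : Word 3) →
                lookup τ 2F Fin.< lookup τ 0F → lookup τ 2F Fin.< lookup τ 1F →
                (∀ {i j k} → i Fin.< j → j Fin.< k →
                 lookup w k Fin.< lookup w i → ¬ lookup w k Fin.< lookup w j) →
                Avoids τ w
sparse⇒avoids w τ 2<0 2<1 sparse
  (i ∷ j ∷ k ∷ [] , ((i<j VecAll.∷ _) VecAllPairs.∷ (j<k VecAll.∷ _) VecAllPairs.∷ _) , iso) =
  sparse i<j j<k (Equivalence.from (iso 2F 0F) 2<0) (Equivalence.from (iso 2F 1F) 2<1)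

module _ (s : ℕ) .{{_ : NonZero s}} where

  avoiding⇒good : {w : Word n} → IsAvoidingExtension (unevenComb s n) w → Good s w
  avoiding⇒good {w = w} ((unique , extension) , no231 , no321) = record
    { injective = inj
    ; sparse    = sparse
    ; monotone  = monotone
    }
    where
    inj : Injective _≡_ _≡_ (lookup w)
    inj = lookup-injective unique _ _

    sparse : ∀ {i j k} → i Fin.< j → j Fin.< k →
             lookup w k Fin.< lookup w i → ¬ lookup w k Fin.< lookup w j
    -- The mutual order of the two larger entries decides which of the two patterns occurs.
    sparse {i} {j} i<j j<k k<i k<j with Fin.<-cmp (lookup w i) (lookup w j)
    ... | tri< lt _ _ = no231 (contains-231 w i<j j<k k<i lt)
    ... | tri≈ _ eq _ = contradiction i<j (Fin.<-irrefl (inj eq))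
    ... | tri> _ _ gt = no321 (contains-321 w i<j j<k k<j gt)

    monotone : ∀ {i j} → Cover s (lookup w i) (lookup w j) → i Fin.< j
    monotone c with _ , _ , lt , i≡ , j≡ ← extension _ _ [ c ] =
      subst₂ Fin._<_ (inj i≡) (inj j≡) lt

  good⇒avoiding : {w : Word n} → Good s w → IsAvoidingExtension (unevenComb s n) w
  good⇒avoiding {w = w} good =
    (subst VecUnique (tabulate∘lookup w) (tabulate⁺ injective) , λ _ _ → precedes) ,
    sparse⇒avoids w p231 z<s z<s sparse ,
    sparse⇒avoids w p321 z<s z<s sparse
    where
    open Good good

    precedes : ∀ {x y} → TransClosure (Cover s) x y → Precedes w x y
    precedes {x} {y} [ c ]
      with i , refl ← injective⇒surjective injective x
         | j , refl ← injective⇒surjective injective y = i , j , monotone c , refl , refl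
    precedes (c ∷ p)
      with i , j , i<j , i≡ , j≡ ← precedes [ c ]
         | k , l , k<l , k≡ , l≡ ← precedes p =
      -- The cover ends at the element where the rest of the chain begins, so by injectivity the
      -- positions j and k coincide.
      i , l , <-trans (subst (i Fin.<_) (injective (trans j≡ (sym k≡))) i<j) k<l , i≡ , l≡

-- Words built from a prefix and a tail headed by the maximum

-- The one-line notation of w is that of π followed by n, m, m+1, …, n−1
-- (0-based entries).
record Extends {m n} (π : Word m) (w : Word (suc n)) : Set where
  field
    prefix : ∀ i k → toℕ k ≡ toℕ i → val w k ≡ val π i
    top    : ∀ k → toℕ k ≡ m → val w k ≡ n
    suffix : ∀ k → m < toℕ k → suc (val w k) ≡ toℕ k

-- Positions are compared as natural numbers because k and i belong to different `Fin` types.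
data Region (m : ℕ) (k : Fin n) : Set where
  before : (i : Fin m) → toℕ k ≡ toℕ i → Region m k
  at     : toℕ k ≡ m → Region m k
  after  : m < toℕ k → Region m k

region : ∀ m (k : Fin n) → Region m k
region m k with <-cmp (toℕ k) m
... | tri< k<m _ _ = before (fromℕ< k<m) (sym (Fin.toℕ-fromℕ< k<m))
... | tri≈ _ k≡m _ = at k≡m
... | tri> _ _ m<k = after m<k

before≢at : {i : Fin m} {a : ℕ} → a ≡ toℕ i → a ≢ m
before≢at {i = i} a≡i a≡m = <⇒≢ (Fin.toℕ<n i) (trans (sym a≡i) a≡m)

before≯ : {i : Fin m} {a : ℕ} → a ≡ toℕ i → ¬ m < a
before≯ {i = i} refl m<i = <-asym m<i (Fin.toℕ<n i)

suc-toℕ-pred : {k : Fin n} → m < toℕ k → suc (toℕ (Fin.pred k)) ≡ toℕ k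
suc-toℕ-pred {k = Fin.suc k} _ = cong suc (Fin.toℕ-inject₁ k)

module _ {m n : ℕ} (m≤n : m ≤ n) where

  private
    m≤1+n : m ≤ suc n
    m≤1+n = m≤n⇒m≤1+n m≤n

    entry : Word m → (k : Fin (suc n)) → Region m k → Fin (suc n)
    entry π _ (before i _) = inject≤ (lookup π i) m≤1+n
    entry π _ (at _)       = fromℕ n
    entry π k (after _)    = Fin.pred k

  extend : Word m → Word (suc n)
  extend π = tabulate λ k → entry π k (region m k)

  extend-extends : ∀ π → Extends π (extend π)
  extend-extends π = record
    { prefix = λ i k k≡i → trans (val-extend k) (prefix i k k≡i (region m k))
    ; top    = λ k k≡m → trans (val-extend k) (top k k≡m (region m k))
    ; suffix = λ k m<k → trans (cong suc (val-extend k)) (suffix k m<k (region m k))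
    }
    where
    val-extend : ∀ k → val (extend π) k ≡ toℕ (entry π k (region m k))
    val-extend k = cong toℕ (lookup∘tabulate (λ k → entry π k (region m k)) k)

    prefix : ∀ i k → toℕ k ≡ toℕ i → (r : Region m k) → toℕ (entry π k r) ≡ val π i
    prefix i k k≡i (before i′ k≡i′) = trans (Fin.toℕ-inject≤ (lookup π i′) m≤1+n)
      (cong (val π) (Fin.toℕ-injective (trans (sym k≡i′) k≡i)))
    prefix i k k≡i (at k≡m)    = contradiction k≡m (before≢at k≡i)
    prefix i k k≡i (after m<k) = contradiction m<k (before≯ k≡i)

    top : ∀ k → toℕ k ≡ m → (r : Region m k) → toℕ (entry π k r) ≡ n
    top k k≡m (before i k≡i) = contradiction k≡m (before≢at k≡i)
    top k k≡m (at _)         = Fin.toℕ-fromℕ n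
    top k k≡m (after m<k)    = contradiction (sym k≡m) (<⇒≢ m<k)

    suffix : ∀ k → m < toℕ k → (r : Region m k) → suc (toℕ (entry π k r)) ≡ toℕ k
    suffix k m<k (before i k≡i) = contradiction m<k (before≯ k≡i)
    suffix k m<k (at k≡m)       = contradiction (sym k≡m) (<⇒≢ m<k)
    suffix k m<k (after _)      = suc-toℕ-pred m<k

  extends-functional : {π : Word m} {w w′ : Word (suc n)} → Extends π w → Extends π w′ → w ≡ w′
  extends-functional {w = w} {w′} e e′ = lookup-extensional λ k → Fin.toℕ-injective (agree k (region m k))
    where
    module E  = Extends e
    module E′ = Extends e′

    agree : ∀ k → Region m k → val w k ≡ val w′ k
    agree k (before i k≡i) = trans (E.prefix i k k≡i) (sym (E′.prefix i k k≡i))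
    agree k (at k≡m)       = trans (E.top k k≡m) (sym (E′.top k k≡m))
    agree k (after m<k)    = suc-injective (trans (E.suffix k m<k) (sym (E′.suffix k m<k)))

  extends-injective : {π π′ : Word m} {w : Word (suc n)} → Extends π w → Extends π′ w → π ≡ π′
  extends-injective e e′ = lookup-extensional λ i → Fin.toℕ-injective
    (trans (sym (Extends.prefix e i _ (Fin.toℕ-inject≤ i m≤1+n)))
           (Extends.prefix e′ i _ (Fin.toℕ-inject≤ i m≤1+n)))

  module _ {π : Word m} {w : Word (suc n)} (ext : Extends π w) where

    open Extends ext

    suffix≥ : ∀ k → m < toℕ k → m ≤ val w k
    suffix≥ k m<k = s≤s⁻¹ (subst (m <_) (sym (suffix k m<k)) m<k)

    -- Used for i before j: `descent` describes the only inversions that are not already inversions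
    -- of the prefix, and all of them start at the position m of the maximum.
    data Comparison (i j : Fin (suc n)) : Set where
      inside  : (a b : Fin m) → toℕ i ≡ toℕ a → toℕ j ≡ toℕ b → Comparison i j
      ascent  : val w i < val w j → Comparison i j
      descent : toℕ i ≡ m → m < toℕ j → Comparison i j

    compare : ∀ {i j} → i Fin.< j → Comparison i j
    compare {i} {j} i<j with region m i | region m j
    ... | before a i≡a | before b j≡b = inside a b i≡a j≡b
    ... | before a i≡a | at j≡m       = ascent (subst₂ _<_ (sym (prefix a i i≡a)) (sym (top j j≡m))
                                          (≤-trans (Fin.toℕ<n (lookup π a)) m≤n))
    ... | before a i≡a | after m<j    = ascent (subst (_< val w j) (sym (prefix a i i≡a))
                                          (≤-trans (Fin.toℕ<n (lookup π a)) (suffix≥ j m<j)))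
    ... | at i≡m       | before b j≡b = contradiction (subst (_< toℕ j) i≡m i<j) (before≯ j≡b)
    ... | at i≡m       | at j≡m       = contradiction (trans i≡m (sym j≡m)) (<⇒≢ i<j)
    ... | at i≡m       | after m<j    = descent i≡m m<j
    ... | after m<i    | before b j≡b = contradiction (<-trans m<i i<j) (before≯ j≡b)
    ... | after m<i    | at j≡m       = contradiction (subst (toℕ i <_) j≡m i<j) (<-asym m<i)
    ... | after m<i    | after m<j    = ascent (s<s⁻¹ (subst₂ _<_ (sym (suffix i m<i)) (sym (suffix j m<j)) i<j))

    -- The prefix keeps its positions and values, and covers depend on labels alone, so each
    -- condition is inherited.
    restrict-good : Good s w → Good s π
    restrict-good good = record
      { injective = λ {i} {j} eq → ι-injective (G.injective
          (Fin.toℕ-injective (trans (val-ι i) (trans (cong toℕ eq) (sym (val-ι j))))))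
      ; sparse    = λ {i} {j} {k} i<j j<k k<i k<j → G.sparse (ι-mono i<j) (ι-mono j<k)
          (subst₂ _<_ (sym (val-ι k)) (sym (val-ι i)) k<i)
          (subst₂ _<_ (sym (val-ι k)) (sym (val-ι j)) k<j)
      ; monotone  = λ {i} {j} c → subst₂ _<_ (toℕ-ι i) (toℕ-ι j)
          (G.monotone (cover-cong (sym (val-ι i)) (sym (val-ι j)) c))
      }
      where
      module G = Good good

      ι : Fin m → Fin (suc n)
      ι i = inject≤ i m≤1+n

      toℕ-ι : ∀ i → toℕ (ι i) ≡ toℕ i
      toℕ-ι i = Fin.toℕ-inject≤ i m≤1+n

      ι-injective : ∀ {i j} → ι i ≡ ι j → i ≡ j
      ι-injective {i} {j} eq = Fin.toℕ-injective (trans (sym (toℕ-ι i)) (trans (cong toℕ eq) (toℕ-ι j)))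

      ι-mono : ∀ {i j} → i Fin.< j → ι i Fin.< ι j
      ι-mono {i} {j} = subst₂ _<_ (sym (toℕ-ι i)) (sym (toℕ-ι j))

      val-ι : ∀ i → val w (ι i) ≡ val π i
      val-ι i = prefix i (ι i) (toℕ-ι i)

    -- A cover read in the wrong order is an inversion. Inside π this contradicts the goodness of π;
    -- otherwise n would cover an entry of the tail, which is at least m, against `covered<m`.
    extend-good : .{{_ : NonZero s}} → (∀ x → Cover s x (fromℕ n) → toℕ x < m) → Good s π → Good s w
    extend-good {s = s} covered<m good = record
      { injective = inj
      ; sparse    = λ i<j j<k k<i → sparse i<j j<k k<i (compare (<-trans i<j j<k)) (compare j<k)
      ; monotone  = monotone
      }
      where
      module G = Good good

      val≡ : ∀ {i} {a : Fin m} → toℕ i ≡ toℕ a → val w i ≡ val π a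
      val≡ {i} {a} = prefix a i

      ≢ : ∀ {i j} → i Fin.< j → Comparison i j → lookup w i ≢ lookup w j
      ≢ i<j (inside a b i≡a j≡b) eq = <⇒≢ i<j (trans i≡a (trans (cong toℕ a≡b) (sym j≡b)))
        where
        a≡b : a ≡ b
        a≡b = G.injective (Fin.toℕ-injective (trans (sym (val≡ i≡a)) (trans (cong toℕ eq) (val≡ j≡b))))
      ≢ i<j (ascent lt) eq = <⇒≢ lt (cong toℕ eq)
      ≢ {i} {j} i<j (descent i≡m m<j) eq =
        1+n≰n (subst (_≤ n) (sym (trans (cong suc (trans (sym (top i i≡m)) (cong toℕ eq))) (suffix j m<j)))
          (s≤s⁻¹ (Fin.toℕ<n j)))

      inj : Injective _≡_ _≡_ (lookup w)
      inj {i} {j} eq with Fin.<-cmp i j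
      ... | tri< i<j _ _ = contradiction eq (≢ i<j (compare i<j))
      ... | tri≈ _ i≡j _ = i≡j
      ... | tri> _ _ j<i = contradiction (sym eq) (≢ j<i (compare j<i))

      sparse : ∀ {i j k} → i Fin.< j → j Fin.< k → lookup w k Fin.< lookup w i →
               Comparison i k → Comparison j k → ¬ lookup w k Fin.< lookup w j
      sparse i<j j<k k<i (ascent lt) _ _ = <-asym lt k<i
      sparse i<j j<k k<i _ (ascent lt) k<j = <-asym lt k<j
      sparse i<j j<k k<i (inside a c i≡a k≡c) (inside b _ j≡b _) k<j =
        G.sparse (subst₂ _<_ i≡a j≡b i<j) (subst₂ _<_ j≡b k≡c j<k)
          (subst₂ _<_ (val≡ k≡c) (val≡ i≡a) k<i)
          (subst₂ _<_ (val≡ k≡c) (val≡ j≡b) k<j)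
      sparse i<j j<k k<i (inside _ _ _ k≡c) (descent _ m<k) _ = before≯ k≡c m<k
      sparse i<j j<k k<i (descent _ m<k) (inside _ _ _ k≡c) _ = before≯ k≡c m<k
      -- Two larger entries before a tail entry would both have to sit at position m.
      sparse i<j j<k k<i (descent i≡m _) (descent j≡m _) _ = <⇒≢ i<j (trans i≡m (sym j≡m))

      monotone : ∀ {i j} → Cover s (lookup w i) (lookup w j) → i Fin.< j
      monotone {i} {j} c with Fin.<-cmp i j
      ... | tri< i<j _ _ = i<j
      ... | tri≈ _ i≡j _ = contradiction (cover⇒< s c) (<-irrefl (cong (val w) i≡j))
      ... | tri> _ _ j<i with compare j<i
      ...   | inside b a j≡b i≡a = contradiction
        (subst₂ _<_ (sym i≡a) (sym j≡b) (G.monotone (cover-cong (val≡ i≡a) (val≡ j≡b) c))) (<-asym j<i)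
      ...   | ascent lt = contradiction (cover⇒< s c) (<-asym lt)
      ...   | descent j≡m m<i = contradiction (suffix≥ i m<i) (<⇒≱ (covered<m (lookup w i)
        (cover-cong refl (trans (top j j≡m) (sym (Fin.toℕ-fromℕ n))) c)))

-- Splitting a good word at its maximum

punchIn-mono-< : ∀ p {i j : Fin n} → i Fin.< j → punchIn p i Fin.< punchIn p j
punchIn-mono-< p {i} {j} i<j = ≰⇒> (<⇒≱ i<j ∘ Fin.punchIn-cancel-≤ p j i)

punchIn-≥ : ∀ p {i : Fin n} → toℕ p ≤ toℕ i → punchIn p i ≡ Fin.suc i
punchIn-≥ Fin.zero    _                     = refl
punchIn-≥ (Fin.suc p) {Fin.suc i} (s≤s p≤i) = cong Fin.suc (punchIn-≥ p p≤i)

module _ {w : Word (suc n)} (good : Good s w) {p : Fin (suc n)} (w[p]≡max : lookup w p ≡ fromℕ n) where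

  open Good good

  private
    q : ℕ
    q = toℕ p

    q≤n : q ≤ n
    q≤n = s≤s⁻¹ (Fin.toℕ<n p)

    val[p]≡n : val w p ≡ n
    val[p]≡n = trans (cong toℕ w[p]≡max) (Fin.toℕ-fromℕ n)

    val<n : ∀ {k} → k ≢ p → val w k < n
    val<n {k} k≢p = ≤∧≢⇒< (s≤s⁻¹ (Fin.toℕ<n (lookup w k)))
      (λ val≡n → k≢p (injective (Fin.toℕ-injective (trans val≡n (sym val[p]≡n)))))

    -- An entry after the maximum n cannot have a second larger entry before it.
    increasing : ∀ {i j} → i Fin.< j → i ≢ p → p Fin.< j → val w i < val w j
    increasing {i} {j} i<j i≢p p<j = ≤∧≢⇒< (≮⇒≥ no-descent)
      (λ eq → <⇒≢ i<j (cong toℕ (injective (Fin.toℕ-injective eq))))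
      where
      val[j]<val[p] : val w j < val w p
      val[j]<val[p] = subst (val w j <_) (sym val[p]≡n) (val<n (λ j≡p → <⇒≢ p<j (cong toℕ (sym j≡p))))

      no-descent : ¬ val w j < val w i
      no-descent lt with Fin.<-cmp i p
      ... | tri< i<p _ _ = sparse i<p p<j lt val[j]<val[p]
      ... | tri≈ _ i≡p _ = i≢p i≡p
      ... | tri> _ _ p<i = sparse p<i i<j val[j]<val[p] lt

    -- The word with its maximum deleted, as a self-map of `Fin n` to which `strong-fixed-point`
    -- applies.
    σ : Fin n → Fin n
    σ i = fromℕ< (val<n (Fin.punchInᵢ≢i p i))

    toℕ-σ : ∀ i → toℕ (σ i) ≡ val w (punchIn p i)
    toℕ-σ i = Fin.toℕ-fromℕ< (val<n (Fin.punchInᵢ≢i p i))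

    σ-injective : Injective _≡_ _≡_ σ
    σ-injective {i} {j} eq = Fin.punchIn-injective p i j
      (injective (Fin.toℕ-injective (trans (sym (toℕ-σ i)) (trans (cong toℕ eq) (toℕ-σ j)))))

    p<punchIn : ∀ {i} → q ≤ toℕ i → p Fin.< punchIn p i
    p<punchIn {i} q≤i = subst (λ k → p Fin.< k) (sym (punchIn-≥ p q≤i)) (s≤s q≤i)

    σ-increasing : ∀ {i j} → i Fin.< j → q ≤ toℕ j → σ i Fin.< σ j
    σ-increasing {i} {j} i<j q≤j = subst₂ _<_ (sym (toℕ-σ i)) (sym (toℕ-σ j))
      (increasing (punchIn-mono-< p i<j) (Fin.punchInᵢ≢i p i) (p<punchIn q≤j))

    -- From index q on, every entry of σ exceeds all earlier ones; hence it is also below all later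
    -- ones and is a strong fixed point.
    σ-fixes : ∀ i → q ≤ toℕ i → σ i ≡ i
    σ-fixes i q≤i = strong-fixed-point σ-injective i
      (λ j j<i → σ-increasing j<i q≤i)
      (λ j i<j → σ-increasing i<j (≤-trans q≤i (<⇒≤ i<j)))

    after-max : ∀ k → q < toℕ k → suc (val w k) ≡ toℕ k
    after-max (Fin.suc i) q<k = cong suc (begin
      val w (Fin.suc i)    ≡⟨ cong (val w) (punchIn-≥ p q≤i) ⟨
      val w (punchIn p i)  ≡⟨ toℕ-σ i ⟨
      toℕ (σ i)            ≡⟨ cong toℕ (σ-fixes i q≤i) ⟩
      toℕ i                ∎)
      where
      open ≡-Reasoning
      q≤i : q ≤ toℕ i
      q≤i = s≤s⁻¹ q<k

    -- If the maximum is last, then q = n and the bound is `val<n`. Otherwise the entry right after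
    -- the maximum equals q, and it exceeds every entry before the maximum.
    before-max : ∀ {k} → toℕ k < q → val w k < q
    before-max {k} k<q with m≤n⇒m<n∨m≡n q≤n
    ... | inj₂ q≡n = subst (val w k <_) (sym q≡n) (val<n k≢p)
      where
      k≢p : k ≢ p
      k≢p k≡p = <⇒≢ k<q (cong toℕ k≡p)
    ... | inj₁ q<n = subst (val w k <_)
      (suc-injective (trans (after-max next p<next) toℕ-next))
      (increasing (<-trans k<q p<next) (λ k≡p → <⇒≢ k<q (cong toℕ k≡p)) p<next)
      where
      next : Fin (suc n)
      next = fromℕ< (s≤s q<n)

      toℕ-next : toℕ next ≡ suc q
      toℕ-next = Fin.toℕ-fromℕ< (s≤s q<n)

      p<next : q < toℕ next
      p<next = subst (q <_) (sym toℕ-next) (n<1+n q)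

  extends-at-max : ∃ λ (π : Word (toℕ p)) → Extends π w
  extends-at-max = π , record
    { prefix = λ i k k≡i → trans
        (cong (val w) (Fin.toℕ-injective (trans k≡i (sym (toℕ-ι i)))))
        (trans (sym (Fin.toℕ-fromℕ< (val-ι<q i))) (cong toℕ (sym (lookup∘tabulate _ i))))
    ; top    = λ k k≡q → trans (cong (val w) (Fin.toℕ-injective k≡q)) val[p]≡n
    ; suffix = after-max
    }
    where
    ι : Fin q → Fin (suc n)
    ι i = inject≤ i (m≤n⇒m≤1+n q≤n)

    toℕ-ι : ∀ i → toℕ (ι i) ≡ toℕ i
    toℕ-ι i = Fin.toℕ-inject≤ i _

    val-ι<q : ∀ i → val w (ι i) < q
    val-ι<q i = before-max (subst (_< q) (sym (toℕ-ι i)) (Fin.toℕ<n i))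

    π : Word q
    π = tabulate λ i → fromℕ< (val-ι<q i)

-- Counting with lists without repetitions

allVecs-unique : ∀ n k → List.Unique (allVecs n k)
allVecs-unique n zero    = [] ∷ []
allVecs-unique n (suc k) =
  Unique.cartesianProductWith⁺ _∷_ ∷-injective (Unique.allFin⁺ n) (allVecs-unique n k)

∈-allVecs : (v : Vec (Fin n) k) → v List.∈ allVecs n k
∈-allVecs []      = Any.here refl
∈-allVecs (x ∷ v) = List.∈-cartesianProductWith⁺ _∷_ (List.∈-allFin x) (∈-allVecs v)

unique∧set⇒length≡ : {xs ys : List X} → List.Unique xs → List.Unique ys →
                     (∀ {x} → x List.∈ xs → x List.∈ ys) → (∀ {x} → x List.∈ ys → x List.∈ xs) →
                     length xs ≡ length ys
unique∧set⇒length≡ xs! ys! xs⊆ys ys⊆xs =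
  ↭-length (∼bag⇒↭ (unique∧set⇒bag xs! ys! (mk⇔ xs⊆ys ys⊆xs)))

length-concat-applyUpTo : (f : ℕ → List X) → ∀ t →
                          length (concat (applyUpTo f t)) ≡ sum (applyUpTo (length ∘ f) t)
length-concat-applyUpTo f zero    = refl
length-concat-applyUpTo f (suc t) = trans (List.length-++ (f 0))
  (cong (length (f 0) +_) (length-concat-applyUpTo (f ∘ suc) t))

-- The recurrence and its two instances

module _ (s : ℕ) .{{_ : NonZero s}} where

  private
    A : ℕ → ℕ
    A n = A₂₃₁,₃₂₁ (unevenComb s n)

  goodWords : ∀ n → List (Word n)
  goodWords n = filter (isAvoidingExtension? (unevenComb s n)) (allVecs n n)

  goodWords-unique : ∀ n → List.Unique (goodWords n)
  goodWords-unique n = Unique.filter⁺ (isAvoidingExtension? (unevenComb s n)) (allVecs-unique n n)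

  ∈-goodWords⁺ : {w : Word n} → Good s w → w List.∈ goodWords n
  ∈-goodWords⁺ {n} {w} good =
    List.∈-filter⁺ (isAvoidingExtension? (unevenComb s n)) (∈-allVecs w) (good⇒avoiding s good)

  ∈-goodWords⁻ : {w : Word n} → w List.∈ goodWords n → Good s w
  ∈-goodWords⁻ {n} w∈ =
    avoiding⇒good s (proj₂ (List.∈-filter⁻ (isAvoidingExtension? (unevenComb s n)) {xs = allVecs n n} w∈))

  -- One recurrence serves both cases, with t = 1 up to length s and t = s beyond it. `covered⇒far`
  -- makes every tail with fewer than t entries after the maximum admissible; `far⇒covered` excludes
  -- the longer ones.
  module _ {n t : ℕ} (t>0 : 0 < t) (t≤1+n : t ≤ suc n)
           (covered⇒far : ∀ x → Cover s x (fromℕ n) → toℕ x + t ≤ n)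
           (far⇒covered : ∀ x → toℕ x + t ≡ n → Cover s x (fromℕ n)) where

    private
      -- For j ≤ n, the index j is the number of entries after the maximum.
      block : ℕ → List (Word (suc n))
      block j = map (extend (m∸n≤m n j)) (goodWords (n ∸ j))

      ∈-block⁻ : ∀ {j w} → w List.∈ block j → ∃ λ (π : Word (n ∸ j)) → Good s π × Extends π w
      ∈-block⁻ {j} w∈ with π , π∈ , refl ← List.∈-map⁻ (extend (m∸n≤m n j)) w∈ =
        π , ∈-goodWords⁻ π∈ , extend-extends (m∸n≤m n j) π

      block-unique : ∀ j → List.Unique (block j)
      block-unique j = Unique.map⁺ extend-injective (goodWords-unique (n ∸ j))
        where
        extend-injective : ∀ {π π′} → extend (m∸n≤m n j) π ≡ extend (m∸n≤m n j) π′ → π ≡ π′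
        extend-injective {π} {π′} eq = extends-injective (m∸n≤m n j)
          (extend-extends (m∸n≤m n j) π)
          (subst (Extends π′) (sym eq) (extend-extends (m∸n≤m n j) π′))

      -- The blocks differ in the position n ∸ j of the maximum.
      blocks-disjoint : ∀ {i j w} → i < j → j < t → ¬ (w List.∈ block i × w List.∈ block j)
      blocks-disjoint {i} {j} {w} i<j j<t (w∈i , w∈j)
        with π , _ , e ← ∈-block⁻ {i} w∈i | π′ , good′ , e′ ← ∈-block⁻ {j} w∈j =
        1+n≰n (subst (_≤ n) (sym 1+n≡pos) (m∸n≤m n i))
        where
        pos : Fin (suc n)
        pos = fromℕ< (s≤s (m∸n≤m n i))

        toℕ-pos : toℕ pos ≡ n ∸ i
        toℕ-pos = Fin.toℕ-fromℕ< (s≤s (m∸n≤m n i))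

        1+n≡pos : suc n ≡ n ∸ i
        -- Position n ∸ i holds n by the first decomposition, but lies in the tail of the second,
        -- where an entry is one less than its position.
        1+n≡pos = begin
          suc n            ≡⟨ cong suc (Extends.top e pos toℕ-pos) ⟨
          suc (val w pos)  ≡⟨ Extends.suffix e′ pos (subst (n ∸ j <_) (sym toℕ-pos)
                                (∸-monoʳ-< i<j (s≤s⁻¹ (≤-trans j<t t≤1+n)))) ⟩
          toℕ pos          ≡⟨ toℕ-pos ⟩
          n ∸ i            ∎
          where open ≡-Reasoning

      ∈-blocks⁻ : ∀ {w} → w List.∈ concat (applyUpTo block t) → w List.∈ goodWords (suc n)
      ∈-blocks⁻ w∈ =
        let
          j , j<t , w∈block = Any.applyUpTo⁻ block (List.∈-concat⁻ (applyUpTo block t) w∈)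
          π , good , e = ∈-block⁻ {j} w∈block
        in ∈-goodWords⁺ (extend-good (m∸n≤m n j) e
          -- From j < t, an element x covered by n satisfies x + j < x + t ≤ n, so x is below the
          -- prefix length n ∸ j.
          (λ x c → m+n≤o⇒m≤o∸n (suc (toℕ x)) (≤-trans (+-monoʳ-< (toℕ x) j<t) (covered⇒far x c))) good)

      -- Otherwise n ∸ t would stand in the tail, after n, although n covers it.
      max-position-late : ∀ {w p} → Good s w → {π : Word (toℕ p)} → Extends π w →
                          lookup w p ≡ fromℕ n → n < toℕ p + t
      max-position-late {w} {p} good e w[p]≡max = ≰⇒> λ p+t≤n →
        let
          p≤n∸t : toℕ p ≤ n ∸ t
          p≤n∸t = m+n≤o⇒m≤o∸n (toℕ p) p+t≤n

          t≤n : t ≤ n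
          t≤n = ≤-trans (m≤n+m t (toℕ p)) p+t≤n

          -- Positivity of t keeps the position of n ∸ t, which is one more than its value, inside
          -- the word.
          1+n∸t≤n : suc (n ∸ t) ≤ n
          1+n∸t≤n = ∸-monoʳ-< t>0 t≤n

          k = fromℕ< (s≤s 1+n∸t≤n)

          toℕ-k : toℕ k ≡ suc (n ∸ t)
          toℕ-k = Fin.toℕ-fromℕ< (s≤s 1+n∸t≤n)

          p<k : p Fin.< k
          p<k = subst (toℕ p <_) (sym toℕ-k) (s≤s p≤n∸t)

          val[k]≡n∸t : val w k ≡ n ∸ t
          val[k]≡n∸t = suc-injective (trans (Extends.suffix e k p<k) toℕ-k)

          k<p : k Fin.< p
          k<p = Good.monotone good (subst (Cover s (lookup w k)) (sym w[p]≡max)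
            (far⇒covered _ (trans (cong (_+ t) val[k]≡n∸t) (m∸n+n≡m t≤n))))
        in <-asym p<k k<p

      ∈-blocks⁺ : ∀ {w} → w List.∈ goodWords (suc n) → w List.∈ concat (applyUpTo block t)
      ∈-blocks⁺ {w} w∈ =
        let
          good = ∈-goodWords⁻ w∈
          p , w[p]≡max = injective⇒surjective (Good.injective good) (fromℕ n)
          π , e = extends-at-max good w[p]≡max
          j = n ∸ toℕ p

          n∸j≡p : n ∸ j ≡ toℕ p
          n∸j≡p = m∸[m∸n]≡n (s≤s⁻¹ (Fin.toℕ<n p))

          j<t : j < t
          j<t = m<n+o⇒m∸n<o n (toℕ p) {{>-nonZero t>0}} (max-position-late good e w[p]≡max)
        in List.∈-concat⁺′ (in-block j n∸j≡p good e) (List.∈-applyUpTo⁺ block j<t)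
        where
        -- The prefix length is generalized to a variable m so that matching on `refl` can retype π.
        in-block : ∀ j {m} → n ∸ j ≡ m → Good s w → {π : Word m} → Extends π w → w List.∈ block j
        in-block j refl good {π} e = subst (List._∈ block j)
          (extends-functional (m∸n≤m n j) (extend-extends (m∸n≤m n j) π) e)
          (List.∈-map⁺ (extend (m∸n≤m n j)) (∈-goodWords⁺ (restrict-good (m∸n≤m n j) e good)))

    recurrence : A (suc n) ≡ sum (applyUpTo (λ j → A (n ∸ j)) t)
    recurrence = begin
      A (suc n)                                          ≡⟨ unique∧set⇒length≡ (goodWords-unique (suc n)) blocks-unique ∈-blocks⁺ ∈-blocks⁻ ⟩
      length (concat (applyUpTo block t))                ≡⟨ length-concat-applyUpTo block t ⟩
      -- The sum passes through `map` over `upTo`, where the lengths can be rewritten pointwise.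
      sum (applyUpTo (length ∘ block) t)                 ≡⟨ cong sum (List.map-upTo (length ∘ block) t) ⟨
      sum (map (length ∘ block) (upTo t))                ≡⟨ cong sum (List.map-cong (λ j → List.length-map _ (goodWords (n ∸ j))) (upTo t)) ⟩
      sum (map (λ j → A (n ∸ j)) (upTo t))               ≡⟨ cong sum (List.map-upTo (λ j → A (n ∸ j)) t) ⟩
      sum (applyUpTo (λ j → A (n ∸ j)) t)                ∎
      where
      open ≡-Reasoning

      blocks-unique : List.Unique (concat (applyUpTo block t))
      blocks-unique = Unique.concat⁺
        (All.applyUpTo⁺₁ block t (λ {j} _ → block-unique j))
        (AllPairs.applyUpTo⁺₁ block t (λ i<j j<t → blocks-disjoint i<j j<t))

  -- With t = 1 only the block j = 0 remains, so the count never changes from its value 1 at length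
  -- 0. The spine supplies the cover needed for `far⇒covered`.
  chain-count : ∀ n → n ≤ s → A n ≡ 1
  chain-count zero    _   = refl
  chain-count (suc n) n<s = trans
    (recurrence z<s (s≤s z≤n) covered⇒far far⇒covered)
    (trans (+-identityʳ (A n)) (chain-count n (<⇒≤ n<s)))
    where
    covered⇒far : ∀ x → Cover s x (fromℕ n) → toℕ x + 1 ≤ n
    covered⇒far x c = subst₂ _≤_ (+-comm 1 (toℕ x)) (Fin.toℕ-fromℕ n) (cover⇒< s c)

    far⇒covered : ∀ x → toℕ x + 1 ≡ n → Cover s x (fromℕ n)
    far⇒covered x x+1≡n = spine
      (m+n≤o⇒m≤o∸n (label x) (subst (_≤ s) (cong suc (sym x+1≡n)) n<s))
      (cong suc (trans (Fin.toℕ-fromℕ n) (sym x+1≡n)))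

  comb-recurrence : ∀ n → s ≤ n → A (suc n) ≡ sum (applyUpTo (λ j → A (n ∸ j)) s)
  comb-recurrence n s≤n = recurrence (>-nonZero⁻¹ s) (m≤n⇒m≤1+n s≤n) covered⇒far far⇒covered
    where
    covered⇒far : ∀ x → Cover s x (fromℕ n) → toℕ x + s ≤ n
    -- The top element has label n + 1 with s ≤ n, past the end of the spine, so only a tooth can
    -- reach it.
    covered⇒far x (spine x<s n≡x+1) = contradiction s≤n (<⇒≱ (begin-strict
      n                ≡⟨ trans (sym (Fin.toℕ-fromℕ n)) (suc-injective n≡x+1) ⟩
      toℕ x + 1        ≡⟨ +-comm (toℕ x) 1 ⟩
      label x          ≤⟨ x<s ⟩
      s ∸ 1            <⟨ ∸-monoʳ-< z<s (>-nonZero⁻¹ s) ⟩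
      s                ∎))
      where open ≤-Reasoning
    covered⇒far x (tooth n≡x+s) =
      ≤-reflexive (trans (sym (suc-injective n≡x+s)) (Fin.toℕ-fromℕ n))

    far⇒covered : ∀ x → toℕ x + s ≡ n → Cover s x (fromℕ n)
    far⇒covered x x+s≡n = tooth (cong suc (trans (Fin.toℕ-fromℕ n) (sym x+s≡n)))

theorem7 : (s : ℕ) .{{_ : NonZero s}} (n : ℕ) →
    (n ≤ s → A₂₃₁,₃₂₁ (unevenComb s n) ≡ 1) ×
    (s < n → A₂₃₁,₃₂₁ (unevenComb s n) ≡
    sum (map (λ j → A₂₃₁,₃₂₁ (unevenComb s (n ∸ j))) (map suc (upTo s))))
theorem7 s n = chain-count s n , λ { (s≤s s≤n) → trans (comb-recurrence s _ s≤n) (sym (cong sum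
  -- Shifting the index from 1,...,s to 0,...,s - 1 costs nothing, since `suc n ∸ suc j` computes to
  -- `n ∸ j`.
  (trans (cong (map _) (List.map-upTo suc s)) (List.map-applyUpTo suc _ s)))) }
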